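{- Let $n\ge 2$ be an integer. The following linear inequality system in the variables $x_{ij}$, $0\le i<j\le n$, is totally dual integral: $x_{0n}\le 1$; $x_{in}\le x_{i-1,n}$ for all $i\in\{1,\dots,n-1\}$; $x_{0i}\le x_{0,i+1}$ for all $i\in\{1,\dots,n-1\}$; $x_{i-1,i+1}\le x_{i-1,i}+x_{i,i+1}$ for all $i\in\{1,\dots,n-1\}$; $x_{j,k}+x_{j+1,k-1}\le x_{j+1,k}+x_{j,k-1}$ for all $j,k\in\{0,\dots,n\}$ with $j<k-2$.
   Context: The variables are indexed by pairs $\{i,j\}\subseteq\{0,\dots,n\}$, written $x_{ij}$ with $i<j$. -}

module Defs where

open import Data.Nat as ℕ using (ℕ; zero; suc; _∸_; _≡ᵇ_)
open import Data.Bool using (Bool; true; false; _∧_; if_then_else_)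
open import Data.Integer as ℤ using (ℤ; +_)
open import Data.Rational as ℚ using (ℚ; _/_)
open import Data.List using (List; []; _∷_; map; upTo; concatMap; foldr; length; lookup; _++_)
open import Data.List.Membership.Propositional using (_∈_)
open import Data.List.Relation.Unary.All using (All)
open import Data.Fin using (Fin) renaming (zero to fzero; suc to fsuc)
open import Data.Product using (Σ; _×_; _,_)
open import Relation.Binary.PropositionalEquality using (_≡_)

record Ineq (V : Set) : Set where
  constructor ineq
  field
    coef : V → ℤ
    rhs  : ℤ
open Ineq public

toℚ : ℤ → ℚ
toℚ z = z / 1

dotℚ : {V : Set} → List V → (V → ℤ) → (V → ℚ) → ℚ
dotℚ vs a x = foldr (λ v s → toℚ (a v) ℚ.* x v ℚ.+ s) (+ 0 / 1) vs

Feasible : {V : Set} → List V → List (Ineq V) → (V → ℚ) → Set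
Feasible vs sys x = All (λ r → dotℚ vs (coef r) x ℚ.≤ toℚ (rhs r)) sys

sumFinℤ : (m : ℕ) → (Fin m → ℤ) → ℤ
sumFinℤ zero    f = + 0
sumFinℤ (suc m) f = f fzero ℤ.+ sumFinℤ m (λ k → f (fsuc k))

-- Total dual integrality (Edmonds–Giles): for every integral objective c
-- for which  max { c·x : A x ≤ b }  is attained (finite) -- witnessed by an
-- optimal point x* -- the dual  min { y·b : y ≥ 0, y A = c }  has an integral
-- optimal solution y (i.e. y ∈ ℕ^m, y A = c and y·b = c·x*; by weak duality
-- such y is dual optimal).
TDI : {V : Set} → List V → List (Ineq V) → Set
TDI {V} vs sys =
  (c : V → ℤ) (xopt : V → ℚ) →
  Feasible vs sys xopt →
  ((x : V → ℚ) → Feasible vs sys x → dotℚ vs c x ℚ.≤ dotℚ vs c xopt) →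
  Σ (Fin (length sys) → ℕ) λ y →
    ((v : V) → v ∈ vs →
       sumFinℤ (length sys) (λ k → + (y k) ℤ.* coef (lookup sys k) v) ≡ c v)
    × (toℚ (sumFinℤ (length sys) (λ k → + (y k) ℤ.* rhs (lookup sys k)))
         ≡ dotℚ vs c xopt)

Var : Set
Var = ℕ × ℕ

vars : ℕ → List Var
vars n = concatMap (λ j → map (λ i → (i , j)) (upTo j)) (upTo (suc n))

e : ℕ → ℕ → Var → ℤ
e i j (k , l) = if (i ≡ᵇ k) ∧ (j ≡ᵇ l) then + 1 else + 0

_⊕_ : (Var → ℤ) → (Var → ℤ) → (Var → ℤ)
(a ⊕ b) v = a v ℤ.+ b v

_⊖_ : (Var → ℤ) → (Var → ℤ) → (Var → ℤ)
(a ⊖ b) v = a v ℤ.- b v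

oneTo : ℕ → List ℕ
oneTo n = map suc (upTo (n ∸ 1))

system : ℕ → List (Ineq Var)
system n =
  ineq (e 0 n) (+ 1)
  ∷ (
      map (λ i → ineq (e i n ⊖ e (i ∸ 1) n) (+ 0)) (oneTo n)
   ++
      map (λ i → ineq (e 0 i ⊖ e 0 (suc i)) (+ 0)) (oneTo n)
   ++
      map (λ i → ineq ((e (i ∸ 1) (suc i) ⊖ e (i ∸ 1) i) ⊖ e i (suc i)) (+ 0))
          (oneTo n)
   ++
      concatMap (λ k → map (λ j →
                   ineq ((e j k ⊕ e (suc j) (k ∸ 1)) ⊖ (e (suc j) k ⊕ e j (k ∸ 1)))
                        (+ 0))
                   (upTo (k ∸ 2)))
                (upTo (suc n)) )

{-# OPTIONS --safe #-}
module Submission where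

-- The slacks of the inequalities are the arc flows of a unit flow in the complete acyclic
-- digraph on 0, …, n+1: the slack of the inequality with leading term x_{jk} sits on the
-- arc j+1 → k, that of x_{0i} ≤ x_{0,i+1} on 0 → i+1, that of x_{in} ≤ x_{i-1,n} on i → n+1,
-- and that of x_{0n} ≤ 1 on 0 → n+1.  The vertices are therefore the paths from 0 to n+1: a path
-- with set S of inner nodes gives x_{ij} = 1 exactly when S meets {i+1, …, j}.  An objective c is a
-- longest path problem with integral arc weights, and the reduced costs of its integral
-- potentials form a dual solution, complementary to a longest path.

open import Defs
open import Data.Nat using (ℕ; _≤_)
open import Data.Nat as ℕ using (zero; suc; _∸_; _<_; z≤n; s≤s; _≤?_; _<?_)
import Data.Nat.Properties as ℕₚ
open import Data.Integer as ℤ using (ℤ; +_; _+_; _*_; _-_; ∣_∣; 0ℤ; 1ℤ)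
import Data.Integer.Properties as ℤₚ
open import Data.Integer.Tactic.RingSolver using (solve-∀)
open import Data.Rational as ℚ using (ℚ)
import Data.Rational.Properties as ℚₚ
import Data.Rational.Unnormalised as ℚᵘ
import Data.Rational.Unnormalised.Properties as ℚᵘₚ
import Data.Rational.Solver as ℚSolver
open import Data.List using (List; []; _∷_; _++_; map; concatMap; upTo; length; lookup)
import Data.List.Properties as Listₚ
open import Data.List.Membership.Propositional using (_∈_; find)
open import Data.List.Membership.Propositional.Properties using (∈-concatMap⁻; ∈-map⁻; ∈-upTo⁻)
open import Data.List.Relation.Unary.Any using (here; there)
open import Data.List.Relation.Unary.All as All using (All; []; _∷_)
import Data.List.Relation.Unary.All.Properties as Allₚ
open import Data.Fin using (Fin) renaming (zero to fzero; suc to fsuc)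
open import Data.Bool using (true; false; T)
open import Data.Unit using (tt)
open import Data.Product using (Σ; ∃; _×_; _,_; proj₁; proj₂)
open import Data.Sum using (_⊎_; inj₁; inj₂)
open import Data.Empty using (⊥-elim)
open import Function using (_∘_; id)
open import Relation.Nullary using (yes; no)
open import Relation.Binary.Definitions using (tri<; tri≈; tri>)
open import Relation.Binary.PropositionalEquality using (_≡_; _≢_; refl; sym; trans; cong; cong₂; subst; module ≡-Reasoning)

-- Finite sums

-- Splitting off the last summand makes an extension of the range by one point hold by computation,
-- which the ring identities of `ΣΔ-peel` and `weight-mixed` rely on.
Σ< : ℕ → (ℕ → ℤ) → ℤ
Σ< zero    f = 0ℤ
Σ< (suc m) f = Σ< m f + f m

Σ<-cong : ∀ m {f g : ℕ → ℤ} → (∀ i → i < m → f i ≡ g i) → Σ< m f ≡ Σ< m g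
Σ<-cong zero    eq = refl
Σ<-cong (suc m) eq =
  cong₂ _+_ (Σ<-cong m (λ i i<m → eq i (ℕₚ.m<n⇒m<1+n i<m))) (eq m (ℕₚ.n<1+n m))

Σ<-zero : ∀ m {f : ℕ → ℤ} → (∀ i → i < m → f i ≡ 0ℤ) → Σ< m f ≡ 0ℤ
Σ<-zero zero    eq = refl
Σ<-zero (suc m) eq =
  cong₂ _+_ (Σ<-zero m (λ i i<m → eq i (ℕₚ.m<n⇒m<1+n i<m))) (eq m (ℕₚ.n<1+n m))

Σ<-+ : ∀ m (f g : ℕ → ℤ) → Σ< m (λ i → f i + g i) ≡ Σ< m f + Σ< m g
Σ<-+ zero    f g = refl
Σ<-+ (suc m) f g = trans (cong (_+ (f m + g m)) (Σ<-+ m f g)) (interchange (Σ< m f) (Σ< m g) (f m) (g m))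
  where
  interchange : ∀ a b c d → (a + b) + (c + d) ≡ (a + c) + (b + d)
  interchange = solve-∀

Σ<-- : ∀ m (f g : ℕ → ℤ) → Σ< m (λ i → f i - g i) ≡ Σ< m f - Σ< m g
Σ<-- zero    f g = refl
Σ<-- (suc m) f g = trans (cong (_+ (f m - g m)) (Σ<-- m f g)) (interchange (Σ< m f) (Σ< m g) (f m) (g m))
  where
  interchange : ∀ a b c d → (a - b) + (c - d) ≡ (a + c) - (b + d)
  interchange = solve-∀

Σ<-head : ∀ m (f : ℕ → ℤ) → Σ< (suc m) f ≡ f 0 + Σ< m (f ∘ suc)
Σ<-head zero    f = ℤₚ.+-comm 0ℤ (f 0)
Σ<-head (suc m) f =
  trans (cong (_+ f (suc m)) (Σ<-head m f)) (ℤₚ.+-assoc (f 0) (Σ< m (f ∘ suc)) (f (suc m)))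

Σ<-single : ∀ m r (f : ℕ → ℤ) → r < m → (∀ i → i < m → i ≢ r → f i ≡ 0ℤ) → Σ< m f ≡ f r
Σ<-single (suc m) r f r<1+m vanish with r ℕ.≟ m
... | yes refl = trans (cong (_+ f m) (Σ<-zero m (λ i i<m → vanish i (ℕₚ.m<n⇒m<1+n i<m) (ℕₚ.<⇒≢ i<m))))
                       (ℤₚ.+-identityˡ (f m))
... | no r≢m   = trans (cong₂ _+_ (Σ<-single m r f (ℕₚ.≤∧≢⇒< (ℕₚ.≤-pred r<1+m) r≢m)
                                     (λ i i<m → vanish i (ℕₚ.m<n⇒m<1+n i<m)))
                                  (vanish m (ℕₚ.n<1+n m) (r≢m ∘ sym)))
                       (ℤₚ.+-identityʳ (f r))

-- The pairs summed over are the arcs `a` → `l` of the complete acyclic digraph on the nodes below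
-- `m`.
ΣΔ : ℕ → (ℕ → ℕ → ℤ) → ℤ
ΣΔ m f = Σ< m (λ l → Σ< l (λ a → f a l))

ΣΔ-cong : ∀ m {f g : ℕ → ℕ → ℤ} → (∀ a l → a < l → l < m → f a l ≡ g a l) → ΣΔ m f ≡ ΣΔ m g
ΣΔ-cong m eq = Σ<-cong m (λ l l<m → Σ<-cong l (λ a a<l → eq a l a<l l<m))

ΣΔ-+ : ∀ m (f g : ℕ → ℕ → ℤ) → ΣΔ m (λ a l → f a l + g a l) ≡ ΣΔ m f + ΣΔ m g
ΣΔ-+ m f g = trans (Σ<-cong m (λ l _ → Σ<-+ l (λ a → f a l) (λ a → g a l)))
                   (Σ<-+ m (λ l → Σ< l (λ a → f a l)) (λ l → Σ< l (λ a → g a l)))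

ΣΔ-- : ∀ m (f g : ℕ → ℕ → ℤ) → ΣΔ m (λ a l → f a l - g a l) ≡ ΣΔ m f - ΣΔ m g
ΣΔ-- m f g = trans (Σ<-cong m (λ l _ → Σ<-- l (λ a → f a l) (λ a → g a l)))
                   (Σ<-- m (λ l → Σ< l (λ a → f a l)) (λ l → Σ< l (λ a → g a l)))

ΣΔ-zero : ∀ m {f : ℕ → ℕ → ℤ} → (∀ a l → a < l → f a l ≡ 0ℤ) → ΣΔ m f ≡ 0ℤ
ΣΔ-zero m eq = Σ<-zero m (λ l _ → Σ<-zero l (λ a → eq a l))

ΣΔ-single : ∀ m r s (f : ℕ → ℕ → ℤ) → r < s → s < m →
            (∀ a l → (a , l) ≢ (r , s) → f a l ≡ 0ℤ) → ΣΔ m f ≡ f r s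
ΣΔ-single m r s f r<s s<m vanish =
  trans (Σ<-single m s _ s<m (λ l _ l≢s → Σ<-zero l (λ a _ → vanish a l (l≢s ∘ cong proj₂))))
        (Σ<-single s r _ r<s (λ a _ a≢r → vanish a s (a≢r ∘ cong proj₁)))

-- Peels the arcs out of 0 and the arcs between consecutive nodes off the triangular sum.
ΣΔ-peel : ∀ m (f : ℕ → ℕ → ℤ) → f 0 1 ≡ 0ℤ →
          ΣΔ (suc (suc m)) f
            ≡ Σ< m (λ t → f 0 (suc (suc t)))
              + (Σ< m (λ t → f (suc t) (suc (suc t)))
                 + Σ< (suc (suc m)) (λ k → Σ< (k ∸ 2) (λ j → f (suc j) k)))
ΣΔ-peel zero    f f01≡0 rewrite f01≡0 = refl
ΣΔ-peel (suc m) f f01≡0 =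
  trans (cong₂ _+_ (ΣΔ-peel m f f01≡0)
                   (cong (_+ f (suc m) (suc (suc m))) (Σ<-head m (λ a → f a (suc (suc m))))))
        (regroup (Σ< m (λ t → f 0 (suc (suc t)))) (Σ< m (λ t → f (suc t) (suc (suc t))))
                 (Σ< (suc (suc m)) (λ k → Σ< (k ∸ 2) (λ j → f (suc j) k)))
                 (f 0 (suc (suc m))) (Σ< m (λ j → f (suc j) (suc (suc m)))) (f (suc m) (suc (suc m))))
  where
  regroup : ∀ A B C a c b → (A + (B + C)) + ((a + c) + b) ≡ (A + a) + ((B + b) + (C + c))
  regroup = solve-∀

-- Sums over lists

sumL : {A : Set} → List A → (A → ℤ) → ℤ
sumL []       f = 0ℤ
sumL (x ∷ xs) f = f x + sumL xs f

sumL-++ : {A : Set} (xs ys : List A) (f : A → ℤ) → sumL (xs ++ ys) f ≡ sumL xs f + sumL ys f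
sumL-++ []       ys f = sym (ℤₚ.+-identityˡ (sumL ys f))
sumL-++ (x ∷ xs) ys f =
  trans (cong (_+_ (f x)) (sumL-++ xs ys f)) (sym (ℤₚ.+-assoc (f x) (sumL xs f) (sumL ys f)))

sumL-map : {A B : Set} (g : A → B) (xs : List A) (f : B → ℤ) → sumL (map g xs) f ≡ sumL xs (f ∘ g)
sumL-map g []       f = refl
sumL-map g (x ∷ xs) f = cong (_+_ (f (g x))) (sumL-map g xs f)

sumL-concatMap : {A B : Set} (g : A → List B) (xs : List A) (f : B → ℤ) →
                 sumL (concatMap g xs) f ≡ sumL xs (λ x → sumL (g x) f)
sumL-concatMap g []       f = refl
sumL-concatMap g (x ∷ xs) f =
  trans (sumL-++ (g x) (concatMap g xs) f) (cong (_+_ (sumL (g x) f)) (sumL-concatMap g xs f))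

sumL-upTo : ∀ m (f : ℕ → ℤ) → sumL (upTo m) f ≡ Σ< m f
sumL-upTo zero    f = refl
sumL-upTo (suc m) f = begin
  sumL (upTo (suc m)) f           ≡⟨ cong (λ xs → sumL xs f) (Listₚ.upTo-∷ʳ m) ⟨
  sumL (upTo m ++ m ∷ []) f       ≡⟨ sumL-++ (upTo m) (m ∷ []) f ⟩
  sumL (upTo m) f + (f m + 0ℤ)    ≡⟨ cong₂ _+_ (sumL-upTo m f) (ℤₚ.+-identityʳ (f m)) ⟩
  Σ< m f + f m                    ∎
  where open ≡-Reasoning

sumL-map-upTo : ∀ {A : Set} m (g : ℕ → A) (f : A → ℤ) → sumL (map g (upTo m)) f ≡ Σ< m (f ∘ g)
sumL-map-upTo m g f = trans (sumL-map g (upTo m) f) (sumL-upTo m (f ∘ g))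

-- Complementary slackness certificates

-- Among the unnormalised rationals an integer has denominator 1 by construction (`mkℚᵘ` stores its
-- predecessor 0), so `toℚ` can be compared with integer arithmetic without any reduction of
-- fractions.
toℚᵘ-toℚ : ∀ i → ℚ.toℚᵘ (toℚ i) ℚᵘ.≃ ℚᵘ.mkℚᵘ i 0
toℚᵘ-toℚ i = ℚₚ.toℚᵘ-fromℚᵘ (ℚᵘ.mkℚᵘ i 0)

toℚ-+ : ∀ i j → toℚ (i + j) ≡ toℚ i ℚ.+ toℚ j
toℚ-+ i j = ℚₚ.toℚᵘ-injective (begin
  ℚ.toℚᵘ (toℚ (i + j))                    ≈⟨ toℚᵘ-toℚ (i + j) ⟩
  ℚᵘ.mkℚᵘ (i + j) 0                       ≈⟨ ℚᵘ.*≡* (unit i j) ⟩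
  ℚᵘ.mkℚᵘ i 0 ℚᵘ.+ ℚᵘ.mkℚᵘ j 0            ≈⟨ ℚᵘₚ.+-cong (toℚᵘ-toℚ i) (toℚᵘ-toℚ j) ⟨
  ℚ.toℚᵘ (toℚ i) ℚᵘ.+ ℚ.toℚᵘ (toℚ j)      ≈⟨ ℚₚ.toℚᵘ-homo-+ (toℚ i) (toℚ j) ⟨
  ℚ.toℚᵘ (toℚ i ℚ.+ toℚ j)                ∎)
  where
  open ℚᵘₚ.≃-Reasoning
  unit : ∀ a b → (a + b) * 1ℤ ≡ (a * 1ℤ + b * 1ℤ) * 1ℤ
  unit = solve-∀

toℚ-* : ∀ i j → toℚ (i * j) ≡ toℚ i ℚ.* toℚ j
toℚ-* i j = ℚₚ.toℚᵘ-injective (begin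
  ℚ.toℚᵘ (toℚ (i * j))                    ≈⟨ toℚᵘ-toℚ (i * j) ⟩
  ℚᵘ.mkℚᵘ i 0 ℚᵘ.* ℚᵘ.mkℚᵘ j 0            ≈⟨ ℚᵘₚ.*-cong (toℚᵘ-toℚ i) (toℚᵘ-toℚ j) ⟨
  ℚ.toℚᵘ (toℚ i) ℚᵘ.* ℚ.toℚᵘ (toℚ j)      ≈⟨ ℚₚ.toℚᵘ-homo-* (toℚ i) (toℚ j) ⟨
  ℚ.toℚᵘ (toℚ i ℚ.* toℚ j)                ∎)
  where open ℚᵘₚ.≃-Reasoning

toℚ-mono-≤ : ∀ {i j} → i ℤ.≤ j → toℚ i ℚ.≤ toℚ j
toℚ-mono-≤ {i} {j} i≤j = ℚₚ.toℚᵘ-cancel-≤ (begin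
  ℚ.toℚᵘ (toℚ i)   ≃⟨ toℚᵘ-toℚ i ⟩
  ℚᵘ.mkℚᵘ i 0      ≤⟨ ℚᵘ.*≤* (ℤₚ.*-monoʳ-≤-nonNeg 1ℤ i≤j) ⟩
  ℚᵘ.mkℚᵘ j 0      ≃⟨ toℚᵘ-toℚ j ⟨
  ℚ.toℚᵘ (toℚ j)   ∎)
  where open ℚᵘₚ.≤-Reasoning

module _ {V : Set} where

  dotℤ : List V → (V → ℤ) → (V → ℤ) → ℤ
  dotℤ vs a z = sumL vs (λ v → a v * z v)

  dotℚ-toℚ : ∀ vs (a z : V → ℤ) → dotℚ vs a (toℚ ∘ z) ≡ toℚ (dotℤ vs a z)
  dotℚ-toℚ []       a z = refl
  dotℚ-toℚ (v ∷ vs) a z =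
    trans (cong₂ ℚ._+_ (sym (toℚ-* (a v) (z v))) (dotℚ-toℚ vs a z))
          (sym (toℚ-+ (a v * z v) (dotℤ vs a z)))

  dotℚ-congˡ : ∀ vs {a b : V → ℤ} (x : V → ℚ) → (∀ v → v ∈ vs → a v ≡ b v) → dotℚ vs a x ≡ dotℚ vs b x
  dotℚ-congˡ []       x eq = refl
  dotℚ-congˡ (v ∷ vs) x eq =
    cong₂ ℚ._+_ (cong (λ i → toℚ i ℚ.* x v) (eq v (here refl))) (dotℚ-congˡ vs x (λ u u∈ → eq u (there u∈)))

  dotℚ-zeroˡ : ∀ vs (x : V → ℚ) → dotℚ vs (λ _ → 0ℤ) x ≡ ℚ.0ℚ
  dotℚ-zeroˡ []       x = refl
  dotℚ-zeroˡ (v ∷ vs) x = trans (cong₂ ℚ._+_ (ℚₚ.*-zeroˡ (x v)) (dotℚ-zeroˡ vs x)) (ℚₚ.+-identityˡ ℚ.0ℚ)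

  dotℚ-linearˡ : ∀ vs k (a b : V → ℤ) (x : V → ℚ) →
                 dotℚ vs (λ v → k * a v + b v) x ≡ toℚ k ℚ.* dotℚ vs a x ℚ.+ dotℚ vs b x
  dotℚ-linearˡ []       k a b x = sym (trans (cong (ℚ._+ ℚ.0ℚ) (ℚₚ.*-zeroʳ (toℚ k))) (ℚₚ.+-identityˡ ℚ.0ℚ))
  dotℚ-linearˡ (v ∷ vs) k a b x =
    trans (cong₂ ℚ._+_ (cong (ℚ._* x v) (trans (toℚ-+ (k * a v) (b v)) (cong (ℚ._+ toℚ (b v)) (toℚ-* k (a v)))))
                       (dotℚ-linearˡ vs k a b x))
          (regroup (toℚ k) (toℚ (a v)) (toℚ (b v)) (x v) (dotℚ vs a x) (dotℚ vs b x))
    where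
    open ℚSolver.+-*-Solver
    regroup : ∀ k a b x A B → (k ℚ.* a ℚ.+ b) ℚ.* x ℚ.+ (k ℚ.* A ℚ.+ B) ≡ k ℚ.* (a ℚ.* x ℚ.+ A) ℚ.+ (b ℚ.* x ℚ.+ B)
    regroup = solve 6 (λ k a b x A B → (k :* a :+ b) :* x :+ (k :* A :+ B) := k :* (a :* x :+ A) :+ (b :* x :+ B)) refl

  -- Keeping each inequality next to its multiplier lets the dual solution be assembled with the
  -- same list operations as the system; `multiplier` recovers the indexed form that `TDI` asks for.
  Weighted : Set
  Weighted = List (Ineq V × ℕ)

  combine : Weighted → (Ineq V → ℤ) → ℤ
  combine W φ = sumL W (λ p → + proj₂ p * φ (proj₁ p))

  multiplier : (W : Weighted) → Fin (length (map proj₁ W)) → ℕ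
  multiplier ((_ , y) ∷ W) fzero    = y
  multiplier ((_ , y) ∷ W) (fsuc k) = multiplier W k

  sumFinℤ-multiplier : ∀ W (φ : Ineq V → ℤ) →
    sumFinℤ (length (map proj₁ W)) (λ k → + multiplier W k * φ (lookup (map proj₁ W) k)) ≡ combine W φ
  sumFinℤ-multiplier []            φ = refl
  sumFinℤ-multiplier ((r , y) ∷ W) φ = cong (_+_ (+ y * φ r)) (sumFinℤ-multiplier W φ)

  combined : Weighted → V → ℤ
  combined W v = combine W (λ r → coef r v)

  weak-duality : ∀ vs W x → Feasible vs (map proj₁ W) x → dotℚ vs (combined W) x ℚ.≤ toℚ (combine W rhs)
  weak-duality vs []            x []         = ℚₚ.≤-reflexive (dotℚ-zeroˡ vs x)
  weak-duality vs ((r , y) ∷ W) x (le ∷ les) = begin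
    dotℚ vs (combined ((r , y) ∷ W)) x                          ≡⟨ dotℚ-linearˡ vs (+ y) (coef r) (combined W) x ⟩
    toℚ (+ y) ℚ.* dotℚ vs (coef r) x ℚ.+ dotℚ vs (combined W) x ≤⟨ ℚₚ.+-mono-≤ (ℚₚ.*-monoˡ-≤-nonNeg (toℚ (+ y)) {{ℚ.nonNegative (toℚ-mono-≤ {0ℤ} {+ y} (ℤ.+≤+ z≤n))}} le) (weak-duality vs W x les) ⟩
    toℚ (+ y) ℚ.* toℚ (rhs r) ℚ.+ toℚ (combine W rhs)           ≡⟨ cong (ℚ._+ toℚ (combine W rhs)) (toℚ-* (+ y) (rhs r)) ⟨
    toℚ (+ y * rhs r) ℚ.+ toℚ (combine W rhs)                   ≡⟨ toℚ-+ (+ y * rhs r) (combine W rhs) ⟨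
    toℚ (combine ((r , y) ∷ W) rhs)                             ∎
    where open ℚₚ.≤-Reasoning

  -- The product form covers both alternatives of complementary slackness, a zero multiplier or a
  -- row met with equality, and is what `strong-duality` sums.
  Complementary : List V → (V → ℤ) → Ineq V × ℕ → Set
  Complementary vs z (r , y) =
    dotℤ vs (coef r) z ℤ.≤ rhs r × + y * dotℤ vs (coef r) z ≡ + y * rhs r

  strong-duality : ∀ vs W z → All (Complementary vs z) W →
                   dotℚ vs (combined W) (toℚ ∘ z) ≡ toℚ (combine W rhs)
  strong-duality vs []            z []               = dotℚ-zeroˡ vs (toℚ ∘ z)
  strong-duality vs ((r , y) ∷ W) z ((_ , eq) ∷ eqs) = begin
    dotℚ vs (combined ((r , y) ∷ W)) x                          ≡⟨ dotℚ-linearˡ vs (+ y) (coef r) (combined W) x ⟩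
    toℚ (+ y) ℚ.* dotℚ vs (coef r) x ℚ.+ dotℚ vs (combined W) x ≡⟨ cong₂ (λ p q → toℚ (+ y) ℚ.* p ℚ.+ q) (dotℚ-toℚ vs (coef r) z) (strong-duality vs W z eqs) ⟩
    toℚ (+ y) ℚ.* toℚ d ℚ.+ toℚ (combine W rhs)                 ≡⟨ cong (ℚ._+ toℚ (combine W rhs)) (toℚ-* (+ y) d) ⟨
    toℚ (+ y * d) ℚ.+ toℚ (combine W rhs)                       ≡⟨ toℚ-+ (+ y * d) (combine W rhs) ⟨
    toℚ (+ y * d + combine W rhs)                               ≡⟨ cong (λ i → toℚ (i + combine W rhs)) eq ⟩
    toℚ (combine ((r , y) ∷ W) rhs)                             ∎
    where
    open ≡-Reasoning
    x = toℚ ∘ z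
    d = dotℤ vs (coef r) z

  complementary⇒feasible : ∀ vs W z → All (Complementary vs z) W → Feasible vs (map proj₁ W) (toℚ ∘ z)
  complementary⇒feasible vs W z cs = Allₚ.map⁺ (All.map
    (λ {p} c → ℚₚ.≤-trans (ℚₚ.≤-reflexive (dotℚ-toℚ vs (coef (proj₁ p)) z)) (toℚ-mono-≤ (proj₁ c))) cs)

  Certificate : List V → List (Ineq V) → (V → ℤ) → Set
  Certificate vs sys c =
    Σ Weighted λ W → Σ (V → ℤ) λ z →
      map proj₁ W ≡ sys × (∀ v → v ∈ vs → combined W v ≡ c v) × All (Complementary vs z) W

  -- The integral point of the certificate may differ from `xopt`. It is feasible, so by optimality
  -- its value, which is the dual value, is at most that of `xopt`; weak duality at `xopt` gives the
  -- other inequality.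
  certificates⇒TDI : ∀ vs sys → (∀ c → Certificate vs sys c) → TDI vs sys
  certificates⇒TDI vs sys certs c xopt feas opt with certs c
  ... | W , z , refl , comb , cs =
    multiplier W
    , (λ v v∈ → trans (sumFinℤ-multiplier W (λ r → coef r v)) (comb v v∈))
    , trans (cong toℚ (sumFinℤ-multiplier W rhs)) (ℚₚ.≤-antisym lower upper)
    where
    open ℚₚ.≤-Reasoning
    lower : toℚ (combine W rhs) ℚ.≤ dotℚ vs c xopt
    lower = begin
      toℚ (combine W rhs)              ≡⟨ strong-duality vs W z cs ⟨
      dotℚ vs (combined W) (toℚ ∘ z)   ≡⟨ dotℚ-congˡ vs (toℚ ∘ z) comb ⟩
      dotℚ vs c (toℚ ∘ z)              ≤⟨ opt (toℚ ∘ z) (complementary⇒feasible vs W z cs) ⟩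
      dotℚ vs c xopt                   ∎
    upper : dotℚ vs c xopt ℚ.≤ toℚ (combine W rhs)
    upper = begin
      dotℚ vs c xopt                   ≡⟨ dotℚ-congˡ vs xopt comb ⟨
      dotℚ vs (combined W) xopt        ≤⟨ weak-duality vs W xopt feas ⟩
      toℚ (combine W rhs)              ∎

-- Longest paths

argmax : ∀ (f : ℕ → ℤ) a d → ∃ λ l → a ≤ l × l ≤ d ℕ.+ a × (∀ k → a ≤ k → k ≤ d ℕ.+ a → f k ℤ.≤ f l)
argmax f a zero = a , ℕₚ.≤-refl , ℕₚ.≤-refl ,
  λ k a≤k k≤a → ℤₚ.≤-reflexive (cong f (ℕₚ.≤-antisym k≤a a≤k))
argmax f a (suc d) with argmax f a d
... | l , a≤l , l≤ , max with ℤₚ.≤-total (f l) (f (suc d ℕ.+ a))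
...   | inj₁ le = suc d ℕ.+ a , ℕₚ.m≤n+m a (suc d) , ℕₚ.≤-refl , bound
  where
  bound : ∀ k → a ≤ k → k ≤ suc d ℕ.+ a → f k ℤ.≤ f (suc d ℕ.+ a)
  bound k a≤k k≤ with ℕₚ.m≤n⇒m<n∨m≡n k≤
  ... | inj₁ k<   = ℤₚ.≤-trans (max k a≤k (ℕₚ.≤-pred k<)) le
  ... | inj₂ refl = ℤₚ.≤-refl
...   | inj₂ ge = l , a≤l , ℕₚ.m≤n⇒m≤1+n l≤ , bound
  where
  bound : ∀ k → a ≤ k → k ≤ suc d ℕ.+ a → f k ℤ.≤ f l
  bound k a≤k k≤ with ℕₚ.m≤n⇒m<n∨m≡n k≤
  ... | inj₁ k<   = max k a≤k (ℕₚ.≤-pred k<)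
  ... | inj₂ refl = ge

module _ (N : ℕ) (g : ℕ → ℕ → ℤ) where

  Tight : (ℕ → ℤ) → ℕ → ℕ → Set
  Tight h i l = h i ≡ g i l + h l

  -- These are the Bellman conditions for longest paths to `N`, restricted to the nodes from `k` on.
  LongestFrom : ℕ → (ℕ → ℤ) → Set
  LongestFrom k h =
    (∀ i l → k ≤ i → i < l → l ≤ N → g i l + h l ℤ.≤ h i)
    × (∀ i → k ≤ i → i < N → ∃ λ l → i < l × l ≤ N × Tight h i l)

  -- Downward induction on `k`: all arcs out of `k` lead to nodes whose values are known, and a best
  -- one among them fixes the value at `k`. Only sums and maxima of arc weights occur, which is why
  -- the potential is integral.
  longestFrom : ∀ d k → d ℕ.+ k ≡ N → ∃ (LongestFrom k)
  longestFrom zero    k refl =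
    (λ _ → 0ℤ)
    , (λ i l k≤i i<l l≤k → ⊥-elim (ℕₚ.<-irrefl refl (ℕₚ.<-≤-trans i<l (ℕₚ.≤-trans l≤k k≤i))))
    , (λ i k≤i i<k → ⊥-elim (ℕₚ.<⇒≱ i<k k≤i))
  longestFrom (suc d) k eq with longestFrom d (suc k) (trans (ℕₚ.+-suc d k) eq)
  ... | h , bound , tight with argmax (λ l → g k l + h l) (suc k) d
  ...   | l₀ , k<l₀ , l₀≤ , max = h′ , bound′ , tight′
    where
    N≡ : d ℕ.+ suc k ≡ N
    N≡ = trans (ℕₚ.+-suc d k) eq
    -- The value placed at nodes before `k` is provisional; nothing is claimed about them until the
    -- induction reaches them.
    h′ : ℕ → ℤ
    h′ i with i ≤? k
    ... | yes _ = g k l₀ + h l₀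
    ... | no  _ = h i
    above : ∀ i → k < i → h′ i ≡ h i
    above i k<i with i ≤? k
    ... | yes i≤k = ⊥-elim (ℕₚ.<⇒≱ k<i i≤k)
    ... | no  _   = refl
    at : h′ k ≡ g k l₀ + h l₀
    at with k ≤? k
    ... | yes _  = refl
    ... | no k≰k = ⊥-elim (k≰k ℕₚ.≤-refl)
    bound′ : ∀ i l → k ≤ i → i < l → l ≤ N → g i l + h′ l ℤ.≤ h′ i
    bound′ i l k≤i i<l l≤N with ℕₚ.m≤n⇒m<n∨m≡n k≤i
    ... | inj₁ k<i rewrite above i k<i | above l (ℕₚ.<-trans k<i i<l) = bound i l k<i i<l l≤N
    ... | inj₂ refl rewrite at | above l i<l = max l i<l (subst (l ≤_) (sym N≡) l≤N)
    tight′ : ∀ i → k ≤ i → i < N → ∃ λ l → i < l × l ≤ N × Tight h′ i l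
    tight′ i k≤i i<N with ℕₚ.m≤n⇒m<n∨m≡n k≤i
    ... | inj₂ refl = l₀ , k<l₀ , subst (l₀ ≤_) N≡ l₀≤ , trans at (cong (_+_ (g k l₀)) (sym (above l₀ k<l₀)))
    ... | inj₁ k<i with tight i k<i i<N
    ...   | l , i<l , l≤N , t =
      l , i<l , l≤N , trans (above i k<i) (trans t (cong (_+_ (g i l)) (sym (above l (ℕₚ.<-trans k<i i<l)))))

-- ν i is the first node after i on a path from k to N all of whose arcs satisfy T.
NextNode : (N : ℕ) (T : ℕ → ℕ → Set) → ℕ → (ℕ → ℕ) → Set
NextNode N T k ν =
  T k (ν k)
  × (∀ i → k ≤ i → i < N → i < ν i × ν i ≤ N)
  × (∀ i → k ≤ i → suc i < N → ν i ≡ ν (suc i) ⊎ (ν i ≡ suc i × T (suc i) (ν (suc i))))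

-- Follow an arc of `T` from `k` to some `l` and recurse at `l`, unless `l` is `N`. Arcs go strictly
-- up, so the distance to `N` shrinks, and `d` bounds it.
nextNode : ∀ N (T : ℕ → ℕ → Set) → (∀ i → i < N → ∃ λ l → i < l × l ≤ N × T i l) →
           ∀ d k → N ≤ d ℕ.+ k → k < N → ∃ (NextNode N T k)
nextNode N T arc zero    k N≤k k<N = ⊥-elim (ℕₚ.<⇒≱ k<N N≤k)
nextNode N T arc (suc d) k N≤  k<N with arc k k<N
... | l , k<l , l≤N , t with ℕₚ.m≤n⇒m<n∨m≡n l≤N
...   | inj₂ refl = (λ _ → N) , t , (λ _ _ i<N → i<N , ℕₚ.≤-refl) , (λ _ _ _ → inj₁ refl)
...   | inj₁ l<N with nextNode N T arc d l (ℕₚ.≤-trans N≤ (subst (_≤ d ℕ.+ l) (ℕₚ.+-suc d k) (ℕₚ.+-monoʳ-≤ d k<l))) l<N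
...     | ν , tₗ , range , step = ν′ , subst (T k) (sym (below k k<l)) t , range′ , step′
  where
  ν′ : ℕ → ℕ
  ν′ i with i <? l
  ... | yes _ = l
  ... | no  _ = ν i
  below : ∀ i → i < l → ν′ i ≡ l
  below i i<l with i <? l
  ... | yes _   = refl
  ... | no  i≮l = ⊥-elim (i≮l i<l)
  above : ∀ i → l ≤ i → ν′ i ≡ ν i
  above i l≤i with i <? l
  ... | yes i<l = ⊥-elim (ℕₚ.<⇒≱ i<l l≤i)
  ... | no  _   = refl
  range′ : ∀ i → k ≤ i → i < N → i < ν′ i × ν′ i ≤ N
  range′ i _ i<N with i <? l
  ... | yes i<l = i<l , l≤N
  ... | no  i≮l = range i (ℕₚ.≮⇒≥ i≮l) i<N
  step′ : ∀ i → k ≤ i → suc i < N → ν′ i ≡ ν′ (suc i) ⊎ (ν′ i ≡ suc i × T (suc i) (ν′ (suc i)))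
  step′ i _ 1+i<N with ℕₚ.<-cmp (suc i) l
  ... | tri< 1+i<l _ _ = inj₁ (trans (below i (ℕₚ.<-trans (ℕₚ.n<1+n i) 1+i<l)) (sym (below (suc i) 1+i<l)))
  -- Here the path arrives at `l`, and the arc that it takes next is the first arc of the
  -- recursively built path.
  ... | tri≈ _ refl _  = inj₂ (below i ℕₚ.≤-refl , subst (T l) (sym (above l ℕₚ.≤-refl)) tₗ)
  ... | tri> _ _ (s≤s l≤i) rewrite above i l≤i | above (suc i) (ℕₚ.m≤n⇒m≤1+n l≤i) = step i l≤i 1+i<N

-- Unit vectors

e-≢ : ∀ i j k l → (i , j) ≢ (k , l) → e i j (k , l) ≡ 0ℤ
e-≢ i j k l neq with i ℕ.≡ᵇ k in eqi | j ℕ.≡ᵇ l in eqj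
... | false | _     = refl
... | true  | false = refl
... | true  | true  = ⊥-elim (neq (cong₂ _,_ (ℕₚ.≡ᵇ⇒≡ i k (subst T (sym eqi) tt)) (ℕₚ.≡ᵇ⇒≡ j l (subst T (sym eqj) tt))))

e-refl : ∀ i j → e i j (i , j) ≡ 1ℤ
e-refl i j with i ℕ.≡ᵇ i in eqi | j ℕ.≡ᵇ j in eqj
... | true  | true  = refl
... | false | _     = ⊥-elim (subst T eqi (ℕₚ.≡⇒≡ᵇ i i refl))
... | true  | false = ⊥-elim (subst T eqj (ℕₚ.≡⇒≡ᵇ j j refl))

-- Off the diagonal exactly one arc contributes. A pair `(s , s)` is no arc, so nothing contributes
-- there, and the vanishing of `f s s` keeps the formula uniform.
ΣΔ-e : ∀ m (f : ℕ → ℕ → ℤ) r s → r ≤ s → s < m → f s s ≡ 0ℤ →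
       ΣΔ m (λ a l → f a l * e a l (r , s)) ≡ f r s
ΣΔ-e m f r s r≤s s<m fss≡0 with ℕₚ.m≤n⇒m<n∨m≡n r≤s
... | inj₁ r<s = trans (ΣΔ-single m r s _ r<s s<m
                          (λ a l neq → trans (cong (f a l *_) (e-≢ a l r s neq)) (ℤₚ.*-zeroʳ (f a l))))
                       (trans (cong (f r s *_) (e-refl r s)) (ℤₚ.*-identityʳ (f r s)))
... | inj₂ refl = trans (ΣΔ-zero m (λ a l a<l → trans (cong (f a l *_) (e-≢ a l s s (λ { refl → ℕₚ.<-irrefl refl a<l })))
                                                     (ℤₚ.*-zeroʳ (f a l))))
                        (sym fss≡0)

dotℤ-vars : ∀ n a z → dotℤ (vars n) a z ≡ ΣΔ (suc n) (λ i j → a (i , j) * z (i , j))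
dotℤ-vars n a z =
  trans (sumL-concatMap (λ j → map (λ i → (i , j)) (upTo j)) (upTo (suc n)) _)
        (trans (sumL-upTo (suc n) _)
               (Σ<-cong (suc n) (λ j _ → sumL-map-upTo j (λ i → (i , j)) (λ v → a v * z v))))

dotℤ-e : ∀ n i j z → i < j → j ≤ n → dotℤ (vars n) (e i j) z ≡ z (i , j)
dotℤ-e n i j z i<j j≤n =
  trans (dotℤ-vars n (e i j) z)
        (trans (ΣΔ-single (suc n) i j _ i<j (s≤s j≤n)
                  (λ k l neq → trans (cong (_* z (k , l)) (e-≢ i j k l (neq ∘ sym))) (ℤₚ.*-zeroˡ (z (k , l)))))
               (trans (cong (_* z (i , j)) (e-refl i j)) (ℤₚ.*-identityˡ (z (i , j)))))

dotℤ-⊕ : ∀ vs a b z → dotℤ vs (a ⊕ b) z ≡ dotℤ vs a z + dotℤ vs b z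
dotℤ-⊕ []       a b z = refl
dotℤ-⊕ (v ∷ vs) a b z = trans (cong (_+_ ((a v + b v) * z v)) (dotℤ-⊕ vs a b z))
                              (regroup (a v) (b v) (z v) (dotℤ vs a z) (dotℤ vs b z))
  where
  regroup : ∀ a b z A B → (a + b) * z + (A + B) ≡ (a * z + A) + (b * z + B)
  regroup = solve-∀

dotℤ-⊖ : ∀ vs a b z → dotℤ vs (a ⊖ b) z ≡ dotℤ vs a z - dotℤ vs b z
dotℤ-⊖ []       a b z = refl
dotℤ-⊖ (v ∷ vs) a b z = trans (cong (_+_ ((a v - b v) * z v)) (dotℤ-⊖ vs a b z))
                              (regroup (a v) (b v) (z v) (dotℤ vs a z) (dotℤ vs b z))
  where
  regroup : ∀ a b z A B → (a - b) * z + (A - B) ≡ (a * z + A) - (b * z + B)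
  regroup = solve-∀

∈-vars⁻ : ∀ n p q → (p , q) ∈ vars n → p < q × q ≤ n
∈-vars⁻ n p q v∈ with find (∈-concatMap⁻ (λ j → map (λ i → (i , j)) (upTo j)) v∈)
... | j , j∈ , v∈ⱼ with ∈-map⁻ (λ i → (i , j)) v∈ⱼ
...   | i , i∈ , refl = ∈-upTo⁻ i∈ , ℕₚ.≤-pred (∈-upTo⁻ j∈)

-- Arc weights, potentials and reduced costs of an objective

module DualSolution (m : ℕ) (c : Var → ℤ) where

  n sink : ℕ
  n    = suc (suc m)
  sink = suc n

  abstract

    -- tail i k = Σ_{k ≤ j ≤ n} c i j  and  weight a l = Σ_{a ≤ i < l ≤ j ≤ n} c i j,
    -- the gain of visiting l right after a.
    tail : ℕ → ℕ → ℤ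
    tail i k = Σ< sink (λ j → c (i , j)) - Σ< k (λ j → c (i , j))

    weight : ℕ → ℕ → ℤ
    weight a l = Σ< l (λ i → tail i l) - Σ< a (λ i → tail i l)

    weight-diag : ∀ a → weight a a ≡ 0ℤ
    weight-diag a = ℤₚ.+-inverseʳ (Σ< a (λ i → tail i a))

    -- The difference between tails `p` and `suc p` is `tail p`, and the difference of that between
    -- `q` and `suc q` is the single entry `c (p , q)`. This is how the dual equations recover the
    -- objective.
    weight-mixed : ∀ p q → (weight p q + weight (suc p) (suc q)) - (weight (suc p) q + weight p (suc q)) ≡ c (p , q)
    weight-mixed p q =
      ring (Σ< q (λ i → tail i q)) (Σ< p (λ i → tail i q)) (Σ< (suc q) (λ i → tail i (suc q)))
           (Σ< p (λ i → tail i (suc q))) (Σ< sink (λ j → c (p , j))) (Σ< q (λ j → c (p , j))) (c (p , q))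
      where
      ring : ∀ A P B Q t s x →
             ((A - P) + (B - (Q + (t - (s + x))))) - ((A - (P + (t - s))) + (B - Q)) ≡ x
      ring = solve-∀

    longest : ∃ (LongestFrom sink weight 0)
    longest = longestFrom sink weight sink 0 (ℕₚ.+-identityʳ sink)

  h : ℕ → ℤ
  h = proj₁ longest

  h-bound : ∀ a l → a < l → l ≤ sink → weight a l + h l ℤ.≤ h a
  h-bound a l = proj₁ (proj₂ longest) a l z≤n

  h-tight : ∀ i → i < sink → ∃ λ l → i < l × l ≤ sink × Tight sink weight h i l
  h-tight i = proj₂ (proj₂ longest) i z≤n

  -- The arc from 0 to 1 has no inequality to carry its reduced cost, so the
  -- potential of node 1 is raised until this arc is tight; 0 → 1 is its only incoming arc.
  π : ℕ → ℤ
  π zero          = h 0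
  π (suc zero)    = h 0 - weight 0 1
  π (suc (suc i)) = h (suc (suc i))

  reduced : ℕ → ℕ → ℤ
  reduced a l = (π a - π l) - weight a l

  -- Loops are not arcs; the value 0 supplies the diagonal hypothesis of `ΣΔ-e`.
  reduced-diag : ∀ a → reduced a a ≡ 0ℤ
  reduced-diag a = cong₂ _-_ (ℤₚ.+-inverseʳ (π a)) (weight-diag a)

  reduced-0-1 : reduced 0 1 ≡ 0ℤ
  reduced-0-1 = ring (h 0) (weight 0 1)
    where
    ring : ∀ a b → (a - (a - b)) - b ≡ 0ℤ
    ring = solve-∀

  -- The arc from `n` to the sink has no inequality either. It is the only arc out of `n`, hence the
  -- tight one that `h-tight` provides.
  reduced-n-sink : reduced n sink ≡ 0ℤ
  reduced-n-sink with h-tight n ℕₚ.≤-refl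
  ... | l , n<l , l≤sink , t with ℕₚ.≤-antisym l≤sink n<l
  ...   | refl rewrite t = ring (weight n sink) (h sink)
    where
    ring : ∀ w k → ((w + k) - k) - w ≡ 0ℤ
    ring = solve-∀

  -- The bound of `h` on the arc 0 → 1 shows that the change at node 1 is indeed upward.
  h≤π : ∀ i → h i ℤ.≤ π i
  h≤π zero          = ℤₚ.≤-refl
  h≤π (suc zero)    = begin
    h 1                              ≡⟨ ring (weight 0 1) (h 1) ⟩
    (weight 0 1 + h 1) - weight 0 1  ≤⟨ ℤₚ.+-monoˡ-≤ (ℤ.- weight 0 1) (h-bound 0 1 (s≤s z≤n) (s≤s z≤n)) ⟩
    h 0 - weight 0 1                 ∎
    where
    open ℤₚ.≤-Reasoning
    ring : ∀ w k → k ≡ (w + k) - w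
    ring = solve-∀
  h≤π (suc (suc i)) = ℤₚ.≤-refl

  -- Raising the potential of node 1 can lower the reduced cost of its incoming arc only, and that
  -- arc is tight by design. For heads from 2 on, the potential of the head is unchanged and that of
  -- the tail did not drop.
  reduced-nonneg : ∀ a l → a < l → l ≤ sink → 0ℤ ℤ.≤ reduced a l
  reduced-nonneg zero    (suc zero)    _ _ = ℤₚ.≤-reflexive (sym reduced-0-1)
  reduced-nonneg (suc a) (suc zero)    (s≤s ()) _
  reduced-nonneg a       (suc (suc l)) a<l l≤sink = begin
    0ℤ                                       ≡⟨ ring (weight a l′) (h l′) ⟩
    ((weight a l′ + h l′) - h l′) - weight a l′ ≤⟨ ℤₚ.+-monoˡ-≤ (ℤ.- weight a l′) (ℤₚ.+-monoˡ-≤ (ℤ.- h l′) (ℤₚ.≤-trans (h-bound a l′ a<l l≤sink) (h≤π a))) ⟩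
    reduced a l′                             ∎
    where
    open ℤₚ.≤-Reasoning
    l′ = suc (suc l)
    ring : ∀ w k → 0ℤ ≡ ((w + k) - k) - w
    ring = solve-∀

  tight⇒reduced : ∀ i l → π i ≡ h i → 2 ≤ l → Tight sink weight h i l → reduced i l ≡ 0ℤ
  tight⇒reduced i (suc (suc l)) πi≡hi _ t rewrite πi≡hi | t = ring (weight i (suc (suc l))) (h (suc (suc l)))
    where
    ring : ∀ w k → ((w + k) - k) - w ≡ 0ℤ
    ring = solve-∀
  tight⇒reduced i (suc zero) _ (s≤s ()) _

  -- An optimal path and its 0/1 point

  abstract
    optimal-path : ∃ (NextNode sink (Tight sink weight h) 0)
    optimal-path = nextNode sink (Tight sink weight h) h-tight sink 0 (ℕₚ.≤-reflexive (sym (ℕₚ.+-identityʳ sink))) (s≤s z≤n)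

  ν : ℕ → ℕ
  ν = proj₁ optimal-path

  ν-range : ∀ i → i < sink → i < ν i × ν i ≤ sink
  ν-range i = proj₁ (proj₂ (proj₂ optimal-path)) i z≤n

  -- If the path starts with 0 → 1, this arc is tight by the choice of `π 1`; any other first arc
  -- joins two nodes at which `π` agrees with `h`.
  reduced-first : reduced 0 (ν 0) ≡ 0ℤ
  reduced-first with ν 0 ℕ.≟ 1
  ... | yes ν0≡1 = trans (cong (reduced 0) ν0≡1) reduced-0-1
  ... | no  ν0≢1 = tight⇒reduced 0 (ν 0) refl (ℕₚ.≤∧≢⇒< (proj₁ (ν-range 0 (s≤s z≤n))) (ν0≢1 ∘ sym)) (proj₁ (proj₂ optimal-path))

  ν-step : ∀ i → suc i < sink → ν i ≡ ν (suc i) ⊎ (ν i ≡ suc i × reduced (suc i) (ν (suc i)) ≡ 0ℤ)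
  ν-step i 1+i<sink with proj₂ (proj₂ (proj₂ optimal-path)) i z≤n 1+i<sink
  ... | inj₁ eq       = inj₁ eq
  ... | inj₂ (eq , t) = inj₂ (eq , tight⇒reduced (suc i) (ν (suc i)) (unraised i eq)
                                     (ℕₚ.≤-trans (s≤s (s≤s z≤n)) (proj₁ (ν-range (suc i) 1+i<sink))) t)
    where
    ring : ∀ w k → (w + k) - w ≡ k
    ring = solve-∀
    -- A path through node 1 arrives along 0 → 1, so this arc was already tight for `h`, and the
    -- potential of node 1 did not change.
    unraised : ∀ i → ν i ≡ suc i → π (suc i) ≡ h (suc i)
    unraised zero    eq = trans (cong (_- weight 0 1) (subst (Tight sink weight h 0) eq (proj₁ (proj₂ optimal-path))))
                                (ring (weight 0 1) (h 1))
    unraised (suc i) eq = refl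

  -- The path visits {i+1, ..., j} exactly when its first node after `i` is at most `j`. If that
  -- node is the sink, the value is 0 for all `j` up to `n`.
  χ : ℕ → ℕ → ℤ
  χ i j with ν i ≤? j
  ... | yes _ = 1ℤ
  ... | no  _ = 0ℤ

  point : Var → ℤ
  point (i , j) = χ i j

  χ-one : ∀ {i j} → ν i ≤ j → χ i j ≡ 1ℤ
  χ-one {i} {j} le with ν i ≤? j
  ... | yes _  = refl
  ... | no  gt = ⊥-elim (gt le)

  χ-zero : ∀ {i j} → j < ν i → χ i j ≡ 0ℤ
  χ-zero {i} {j} gt with ν i ≤? j
  ... | yes le = ⊥-elim (ℕₚ.<⇒≱ gt le)
  ... | no  _  = refl

  χ-cong : ∀ {i k} j → ν i ≡ ν k → χ i j ≡ χ k j
  χ-cong {i} {k} j eq with ν i ≤? j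
  ... | yes le = sym (χ-one (subst (_≤ j) eq le))
  ... | no  gt = sym (χ-zero (subst (j <_) eq (ℕₚ.≰⇒> gt)))

  -- As `j` grows, the value jumps only on reaching the node `ν i`.
  χ-next : ∀ i j → χ i j ≡ χ i (suc j) ⊎ (ν i ≡ suc j × χ i j ≡ 0ℤ × χ i (suc j) ≡ 1ℤ)
  χ-next i j with ℕₚ.<-cmp (ν i) (suc j)
  ... | tri< (s≤s le) _ _ = inj₁ (trans (χ-one le) (sym (χ-one (ℕₚ.m≤n⇒m≤1+n le))))
  ... | tri≈ _ eq _ = inj₂ (eq , χ-zero (ℕₚ.≤-reflexive (sym eq)) , χ-one (ℕₚ.≤-reflexive eq))
  ... | tri> _ _ gt = inj₁ (trans (χ-zero (ℕₚ.<-trans (ℕₚ.n<1+n j) gt)) (sym (χ-zero gt)))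

  -- Complementary slackness of the path, row by row

  Slack : ℤ → ℤ → ℤ → Set
  Slack y d b = d ≡ b ⊎ (d ℤ.≤ b × y ≡ 0ℤ)

  slack-source-sink : Slack (reduced 0 sink) (χ 0 n) 1ℤ
  slack-source-sink with ν 0 ≤? n
  ... | yes le = inj₁ refl
  ... | no  gt = inj₂ (ℤ.+≤+ z≤n , subst (λ l → reduced 0 l ≡ 0ℤ) ν0≡sink reduced-first)
    where
    ν0≡sink : ν 0 ≡ sink
    ν0≡sink = ℕₚ.≤-antisym (proj₂ (ν-range 0 (s≤s z≤n))) (ℕₚ.≰⇒> gt)

  -- Strictness requires the path to visit `suc t` and to go from there straight to the sink, along
  -- an arc of reduced cost 0.
  slack-sink : ∀ t → t < suc m → Slack (reduced (suc t) sink) (χ (suc t) n - χ t n) 0ℤ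
  slack-sink t t<1+m with ν-step t (s≤s (ℕₚ.m≤n⇒m≤1+n t<1+m))
  ... | inj₁ eq rewrite χ-cong n eq = inj₁ (ℤₚ.+-inverseʳ (χ (suc t) n))
  ... | inj₂ (eq , tight) rewrite χ-one {t} {n} (subst (_≤ n) (sym eq) (ℕₚ.m≤n⇒m≤1+n t<1+m)) with ν (suc t) ≤? n
  ...   | yes le = inj₁ refl
  ...   | no  gt = inj₂ (ℤ.-≤+ , subst (λ l → reduced (suc t) l ≡ 0ℤ) ν≡sink tight)
    where
    ν≡sink : ν (suc t) ≡ sink
    ν≡sink = ℕₚ.≤-antisym (proj₂ (ν-range (suc t) (s≤s (ℕₚ.m≤n⇒m≤1+n t<1+m)))) (ℕₚ.≰⇒> gt)

  slack-source : ∀ t → Slack (reduced 0 (suc (suc t))) (χ 0 (suc t) - χ 0 (suc (suc t))) 0ℤ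
  slack-source t with χ-next 0 (suc t)
  ... | inj₁ eq rewrite eq = inj₁ (ℤₚ.+-inverseʳ (χ 0 (suc (suc t))))
  ... | inj₂ (eq , χ≡0 , χ≡1) rewrite χ≡0 | χ≡1 =
    inj₂ (ℤ.-≤+ , subst (λ l → reduced 0 l ≡ 0ℤ) eq reduced-first)

  -- If the path skips `suc j`, the values for `j` and `suc j` agree and cancel. If it visits
  -- `suc j`, both values for `j` are 1, and slack remains only when `suc k` comes next, that is,
  -- when the arc `suc j` → `suc k` lies on the path. The case of `k` equal to `suc j` serves
  -- `slack-triangle`.
  slack-inner : ∀ j k → suc j ≤ k → suc k ≤ n →
                Slack (reduced (suc j) (suc k)) ((χ j (suc k) + χ (suc j) k) - (χ (suc j) (suc k) + χ j k)) 0ℤ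
  slack-inner j k j<k k<n with ν-step j (s≤s (ℕₚ.≤-trans j<k (ℕₚ.<⇒≤ k<n)))
  ... | inj₁ eq rewrite χ-cong k eq | χ-cong (suc k) eq =
    inj₁ (ℤₚ.+-inverseʳ (χ (suc j) (suc k) + χ (suc j) k))
  ... | inj₂ (eq , tight) rewrite χ-one {j} {k} (subst (_≤ k) (sym eq) j<k)
                                | χ-one {j} {suc k} (subst (_≤ suc k) (sym eq) (ℕₚ.m≤n⇒m≤1+n j<k))
                          with χ-next (suc j) k
  ...   | inj₁ same rewrite same = inj₁ (ring (χ (suc j) (suc k)))
    where
    ring : ∀ a → (1ℤ + a) - (a + 1ℤ) ≡ 0ℤ
    ring = solve-∀
  ...   | inj₂ (ν≡ , χ≡0 , χ≡1) rewrite χ≡0 | χ≡1 =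
    inj₂ (ℤ.-≤+ , subst (λ l → reduced (suc j) l ≡ 0ℤ) ν≡ tight)

  -- A triangle row is an inner row with the absent variable of equal indices `suc t` read as 0. The
  -- formula for the point gives 0 there too, since the node after `suc t` is larger.
  slack-triangle : ∀ t → t < suc m →
    Slack (reduced (suc t) (suc (suc t))) ((χ t (suc (suc t)) - χ t (suc t)) - χ (suc t) (suc (suc t))) 0ℤ
  slack-triangle t t<1+m =
    subst (λ d → Slack (reduced (suc t) (suc (suc t))) d 0ℤ)
          (trans (cong (λ i → (χ t (suc (suc t)) + i) - (χ (suc t) (suc (suc t)) + χ t (suc t)))
                       (χ-zero {suc t} (proj₁ (ν-range (suc t) (s≤s (ℕₚ.m≤n⇒m≤1+n t<1+m))))))
                 (ring (χ t (suc (suc t))) (χ (suc t) (suc (suc t))) (χ t (suc t))))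
          (slack-inner t (suc t) ℕₚ.≤-refl (s≤s t<1+m))
    where
    ring : ∀ a b c → (a + 0ℤ) - (b + c) ≡ (a - c) - b
    ring = solve-∀

  -- The dual solution attached to the system

  y : ℕ → ℕ → ℕ
  y a l = ∣ reduced a l ∣

  -- The absolute value only converts to a natural number: on arcs the reduced cost is already
  -- nonnegative.
  +y≡reduced : ∀ a l → a < l → l ≤ sink → + y a l ≡ reduced a l
  +y≡reduced a l a<l l≤sink = ℤₚ.0≤i⇒+∣i∣≡i (reduced-nonneg a l a<l l≤sink)

  -- Each row gets the reduced cost of the arc whose flow is the slack of that row.
  sink-row source-row triangle-row : ℕ → Ineq Var × ℕ
  sink-row     i = ineq (e i n ⊖ e (i ∸ 1) n) (+ 0) , y i sink
  source-row   i = ineq (e 0 i ⊖ e 0 (suc i)) (+ 0) , y 0 (suc i)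
  triangle-row i = ineq ((e (i ∸ 1) (suc i) ⊖ e (i ∸ 1) i) ⊖ e i (suc i)) (+ 0) , y i (suc i)

  inner-rows : ℕ → List (Ineq Var × ℕ)
  inner-rows k =
    map (λ j → (ineq ((e j k ⊕ e (suc j) (k ∸ 1)) ⊖ (e (suc j) k ⊕ e j (k ∸ 1))) (+ 0) , y (suc j) k))
        (upTo (k ∸ 2))

  weighted : List (Ineq Var × ℕ)
  weighted =
    (ineq (e 0 n) (+ 1) , y 0 sink)
    ∷ map sink-row (oneTo n) ++ map source-row (oneTo n) ++ map triangle-row (oneTo n) ++ concatMap inner-rows (upTo sink)

  weighted-rows : map proj₁ weighted ≡ system n
  weighted-rows = cong (ineq (e 0 n) (+ 1) ∷_)
    (split (map sink-row (oneTo n)) (sym (Listₚ.map-∘ (oneTo n)))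
    (split (map source-row (oneTo n)) (sym (Listₚ.map-∘ (oneTo n)))
    (split (map triangle-row (oneTo n)) (sym (Listₚ.map-∘ (oneTo n)))
    (trans (Listₚ.map-concatMap proj₁ inner-rows (upTo sink))
           (Listₚ.concatMap-cong (λ k → sym (Listₚ.map-∘ (upTo (k ∸ 2)))) (upTo sink))))))
    where
    split : ∀ (xs : List (Ineq Var × ℕ)) {ys us ws} →
            map proj₁ xs ≡ us → map proj₁ ys ≡ ws → map proj₁ (xs ++ ys) ≡ us ++ ws
    split xs {ys} eq₁ eq₂ = trans (Listₚ.map-++ proj₁ xs ys) (cong₂ _++_ eq₁ eq₂)

  slack⇒complementary : ∀ a l r {d} → dotℤ (vars n) (coef r) point ≡ d → Slack (reduced a l) d (rhs r) →
                        Complementary (vars n) point (r , y a l)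
  slack⇒complementary a l r refl (inj₁ eq) = ℤₚ.≤-reflexive eq , cong (+ y a l *_) eq
  slack⇒complementary a l r refl (inj₂ (le , y≡0)) =
    le , trans (cong (λ i → + ∣ i ∣ * _) y≡0) (sym (cong (λ i → + ∣ i ∣ * _) y≡0))

  complementary : All (Complementary (vars n) point) weighted
  complementary =
    slack⇒complementary 0 sink (ineq (e 0 n) (+ 1)) (dotℤ-e n 0 n point (s≤s z≤n) ℕₚ.≤-refl) slack-source-sink
    ∷ Allₚ.++⁺ (over-oneTo λ t t< →
        slack⇒complementary (suc t) sink (ineq (e (suc t) n ⊖ e t n) (+ 0))
          (trans (dotℤ-⊖ (vars n) (e (suc t) n) (e t n) point)
                 (cong₂ _-_ (at (suc t) n (s≤s t<) ℕₚ.≤-refl) (at t n (ℕₚ.m≤n⇒m≤1+n t<) ℕₚ.≤-refl)))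
          (slack-sink t t<))
      (Allₚ.++⁺ (over-oneTo λ t t< →
        slack⇒complementary 0 (suc (suc t)) (ineq (e 0 (suc t) ⊖ e 0 (suc (suc t))) (+ 0))
          (trans (dotℤ-⊖ (vars n) (e 0 (suc t)) (e 0 (suc (suc t))) point)
                 (cong₂ _-_ (at 0 (suc t) (s≤s z≤n) (ℕₚ.m≤n⇒m≤1+n t<)) (at 0 (suc (suc t)) (s≤s z≤n) (s≤s t<))))
          (slack-source t))
      (Allₚ.++⁺ (over-oneTo λ t t< →
        slack⇒complementary (suc t) (suc (suc t)) (ineq ((e t (suc (suc t)) ⊖ e t (suc t)) ⊖ e (suc t) (suc (suc t))) (+ 0))
          (trans (dotℤ-⊖ (vars n) (e t (suc (suc t)) ⊖ e t (suc t)) (e (suc t) (suc (suc t))) point)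
                 (cong₂ _-_ (trans (dotℤ-⊖ (vars n) (e t (suc (suc t))) (e t (suc t)) point)
                                   (cong₂ _-_ (at t (suc (suc t)) (ℕₚ.m≤n⇒m≤1+n ℕₚ.≤-refl) (s≤s t<))
                                              (at t (suc t) ℕₚ.≤-refl (ℕₚ.m≤n⇒m≤1+n t<))))
                            (at (suc t) (suc (suc t)) ℕₚ.≤-refl (s≤s t<))))
          (slack-triangle t t<))
      (Allₚ.concat⁺ (Allₚ.map⁺ (Allₚ.applyUpTo⁺₁ id (suc n) λ {k} k< →
        Allₚ.map⁺ (Allₚ.applyUpTo⁺₁ id (k ∸ 2) λ {j} j< → inner k k< j j<))))))
    where
    at : ∀ i j → i < j → j ≤ n → dotℤ (vars n) (e i j) point ≡ χ i j
    at i j = dotℤ-e n i j point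
    over-oneTo : ∀ {f : ℕ → Ineq Var × ℕ} → (∀ t → t < suc m → Complementary (vars n) point (f (suc t))) →
                 All (Complementary (vars n) point) (map f (oneTo n))
    over-oneTo H = Allₚ.map⁺ (Allₚ.map⁺ (Allₚ.applyUpTo⁺₁ id (suc m) λ {t} → H t))
    inner : ∀ k → k < suc n → ∀ j → j < k ∸ 2 →
            Complementary (vars n) point
              (ineq ((e j k ⊕ e (suc j) (k ∸ 1)) ⊖ (e (suc j) k ⊕ e j (k ∸ 1))) (+ 0) , y (suc j) k)
    inner (suc (suc k)) (s≤s k≤n) j j<k =
      slack⇒complementary (suc j) (suc (suc k))
        (ineq ((e j (suc (suc k)) ⊕ e (suc j) (suc k)) ⊖ (e (suc j) (suc (suc k)) ⊕ e j (suc k))) (+ 0))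
        (trans (dotℤ-⊖ (vars n) (e j (suc (suc k)) ⊕ e (suc j) (suc k)) (e (suc j) (suc (suc k)) ⊕ e j (suc k)) point)
               (cong₂ _-_
                 (trans (dotℤ-⊕ (vars n) (e j (suc (suc k))) (e (suc j) (suc k)) point)
                        (cong₂ _+_ (at j (suc (suc k)) (ℕₚ.m≤n⇒m≤1+n (ℕₚ.m≤n⇒m≤1+n j<k)) k≤n)
                                   (at (suc j) (suc k) (s≤s j<k) (ℕₚ.<⇒≤ k≤n))))
                 (trans (dotℤ-⊕ (vars n) (e (suc j) (suc (suc k))) (e j (suc k)) point)
                        (cong₂ _+_ (at (suc j) (suc (suc k)) (s≤s (ℕₚ.m≤n⇒m≤1+n j<k)) k≤n)
                                   (at j (suc k) (ℕₚ.m≤n⇒m≤1+n j<k) (ℕₚ.<⇒≤ k≤n))))))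
        (slack-inner j (suc k) (ℕₚ.m≤n⇒m≤1+n j<k) k≤n)

  -- The dual equations, one for each variable

  module _ (p q : ℕ) (p<q : p < q) (q≤n : q ≤ n) where

    -- The coefficient of x_{pq} in the inequality of the arc a → l.
    δ : ℕ → ℕ → ℤ
    δ a l = (e a l (suc p , q) + e a l (p , suc q)) - (e a l (p , q) + e a l (suc p , suc q))

    term : ℕ → ℕ → ℤ
    term a l = reduced a l * δ a l

    -- At most four arcs meet the column of x_{pq}, and their reduced costs enter with the signs of
    -- a mixed second difference. Each potential depends on one endpoint only and cancels, which
    -- leaves the mixed difference of `weight`.
    ΣΔ-term : ΣΔ (suc sink) term ≡ c (p , q)
    ΣΔ-term = begin
      ΣΔ (suc sink) term
        ≡⟨ ΣΔ-cong (suc sink) (λ a l _ _ → expand (reduced a l) (e a l (suc p , q)) (e a l (p , suc q)) (e a l (p , q)) (e a l (suc p , suc q))) ⟩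
      ΣΔ (suc sink) (λ a l → (part (suc p) q a l + part p (suc q) a l) - (part p q a l + part (suc p) (suc q) a l))
        ≡⟨ ΣΔ-- (suc sink) (λ a l → part (suc p) q a l + part p (suc q) a l) (λ a l → part p q a l + part (suc p) (suc q) a l) ⟩
      ΣΔ (suc sink) (λ a l → part (suc p) q a l + part p (suc q) a l) - ΣΔ (suc sink) (λ a l → part p q a l + part (suc p) (suc q) a l)
        ≡⟨ cong₂ _-_ (ΣΔ-+ (suc sink) (part (suc p) q) (part p (suc q))) (ΣΔ-+ (suc sink) (part p q) (part (suc p) (suc q))) ⟩
      (ΣΔ (suc sink) (part (suc p) q) + ΣΔ (suc sink) (part p (suc q))) - (ΣΔ (suc sink) (part p q) + ΣΔ (suc sink) (part (suc p) (suc q)))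
        -- For `q` equal to `suc p` the pair `(suc p , q)` lies on the diagonal; for its sake `pick`
        -- admits `r` equal to `s`.
        ≡⟨ cong₂ _-_ (cong₂ _+_ (pick (suc p) q p<q q<) (pick p (suc q) (ℕₚ.m≤n⇒m≤1+n (ℕₚ.<⇒≤ p<q)) (s≤s (s≤s q≤n))))
                     (cong₂ _+_ (pick p q (ℕₚ.<⇒≤ p<q) q<) (pick (suc p) (suc q) (s≤s (ℕₚ.<⇒≤ p<q)) (s≤s (s≤s q≤n)))) ⟩
      (reduced (suc p) q + reduced p (suc q)) - (reduced p q + reduced (suc p) (suc q))
        ≡⟨ cancel (π p) (π (suc p)) (π q) (π (suc q)) (weight (suc p) q) (weight p (suc q)) (weight p q) (weight (suc p) (suc q)) ⟩
      (weight p q + weight (suc p) (suc q)) - (weight (suc p) q + weight p (suc q))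
        ≡⟨ weight-mixed p q ⟩
      c (p , q) ∎
      where
      open ≡-Reasoning
      part : ℕ → ℕ → ℕ → ℕ → ℤ
      part r s a l = reduced a l * e a l (r , s)
      q< : q < suc sink
      q< = s≤s (ℕₚ.m≤n⇒m≤1+n q≤n)
      pick : ∀ r s → r ≤ s → s < suc sink → ΣΔ (suc sink) (part r s) ≡ reduced r s
      pick r s r≤s s< = ΣΔ-e (suc sink) reduced r s r≤s s< (reduced-diag s)
      expand : ∀ y a b c d → y * ((a + b) - (c + d)) ≡ (y * a + y * b) - (y * c + y * d)
      expand = solve-∀
      cancel : ∀ P P′ Q Q′ A B C D →
               (((P′ - Q) - A) + ((P - Q′) - B)) - (((P - Q) - C) + ((P′ - Q′) - D)) ≡ (C + D) - (A + B)
      cancel = solve-∀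

    term-zero : ∀ {i} a → reduced a i ≡ 0ℤ → term a i ≡ 0ℤ
    term-zero {i} a eq = trans (cong (_* δ a i) eq) (ℤₚ.*-zeroˡ (δ a i))

    -- No variable has second index `sink` or two equal indices. Adding such zero entries, here and
    -- with `e-diag`, brings the rows of the sink and the triangle rows to the four-term shape of
    -- `δ`.
    e-sink : ∀ i r → e i sink (r , q) ≡ 0ℤ
    e-sink i r = e-≢ i sink r q (λ { refl → ℕₚ.<-irrefl refl q≤n })

    e-diag : ∀ i → e i i (p , q) ≡ 0ℤ
    e-diag i = e-≢ i i p q (λ { refl → ℕₚ.<-irrefl refl p<q })

    combined-weighted : combined weighted (p , q) ≡ c (p , q)
    combined-weighted = begin
      combined weighted (p , q)
        ≡⟨ cong₂ _+_ row-source-sink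
             (split (map sink-row (oneTo n)) (over-oneTo sink-row rows-sink)
             (split (map source-row (oneTo n)) (over-oneTo source-row rows-source)
             (split (map triangle-row (oneTo n)) (over-oneTo triangle-row rows-triangle) rows-inner))) ⟩
      term 0 sink + (Σ< (suc m) (λ t → term (suc t) sink) + (A + (B + C)))
        ≡⟨ regroup (term 0 sink) (Σ< (suc m) (λ t → term (suc t) sink)) (A + (B + C)) ⟩
      (A + (B + C)) + ((term 0 sink + Σ< (suc m) (λ t → term (suc t) sink)) + 0ℤ)
        -- The sum over all arcs first splits off the arcs into the sink, and `ΣΔ-peel` sorts the
        -- others by kind of row. The two arcs without an inequality, 0 → 1 and `n` → `sink`,
        -- contribute nothing because their reduced costs are 0.
        ≡⟨ cong₂ _+_ (ΣΔ-peel (suc m) term (term-zero 0 reduced-0-1))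
                     (cong₂ _+_ (Σ<-head (suc m) (λ a → term a sink)) (term-zero n reduced-n-sink)) ⟨
      ΣΔ (suc sink) term
        ≡⟨ ΣΔ-term ⟩
      c (p , q) ∎
      where
      open ≡-Reasoning
      A = Σ< (suc m) (λ t → term 0 (suc (suc t)))
      B = Σ< (suc m) (λ t → term (suc t) (suc (suc t)))
      C = Σ< sink (λ k → Σ< (k ∸ 2) (λ j → term (suc j) k))
      regroup : ∀ a b c → a + (b + c) ≡ c + ((a + b) + 0ℤ)
      regroup = solve-∀

      value : Ineq Var × ℕ → ℤ
      value (r , y) = + y * coef r (p , q)

      split : ∀ xs {ys a b} → sumL xs value ≡ a → sumL ys value ≡ b → sumL (xs ++ ys) value ≡ a + b
      split xs {ys} eq₁ eq₂ = trans (sumL-++ xs ys value) (cong₂ _+_ eq₁ eq₂)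

      over-oneTo : ∀ f {g} → (∀ t → t < suc m → value (f (suc t)) ≡ g t) →
                   sumL (map f (oneTo n)) value ≡ Σ< (suc m) g
      over-oneTo f eq = trans (sumL-map f (oneTo n) value)
                         (trans (sumL-map-upTo (suc m) suc (value ∘ f)) (Σ<-cong (suc m) eq))

      row : ∀ a l {x} → a < l → l ≤ sink → x ≡ δ a l → + y a l * x ≡ term a l
      row a l a<l l≤ eq = cong₂ _*_ (+y≡reduced a l a<l l≤) eq

      row-source-sink : + y 0 sink * e 0 n (p , q) ≡ term 0 sink
      row-source-sink = row 0 sink (s≤s z≤n) ℕₚ.≤-refl
        (trans (ring (e 0 n (p , q))) (cong (λ i → (0ℤ + e 0 n (p , q)) - (i + 0ℤ)) (sym (e-sink 0 p))))
        where
        ring : ∀ a → a ≡ (0ℤ + a) - (0ℤ + 0ℤ)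
        ring = solve-∀

      rows-sink : ∀ t → t < suc m → + y (suc t) sink * (e (suc t) n (p , q) - e t n (p , q)) ≡ term (suc t) sink
      rows-sink t t< = row (suc t) sink (s≤s (ℕₚ.m≤n⇒m≤1+n t<)) ℕₚ.≤-refl
        (trans (ring (e (suc t) n (p , q)) (e t n (p , q)))
               (cong₂ (λ i j → (i + e (suc t) n (p , q)) - (j + e t n (p , q)))
                      (sym (e-sink (suc t) (suc p))) (sym (e-sink (suc t) p))))
        where
        ring : ∀ a b → a - b ≡ (0ℤ + a) - (0ℤ + b)
        ring = solve-∀

      rows-source : ∀ t → t < suc m → + y 0 (suc (suc t)) * (e 0 (suc t) (p , q) - e 0 (suc (suc t)) (p , q)) ≡ term 0 (suc (suc t))
      -- For tail 0 the two entries of `δ` with first index `suc p` vanish by computation.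
      rows-source t t< = row 0 (suc (suc t)) (s≤s z≤n) (s≤s (ℕₚ.m≤n⇒m≤1+n t<))
        (ring (e 0 (suc t) (p , q)) (e 0 (suc (suc t)) (p , q)))
        where
        ring : ∀ a b → a - b ≡ (0ℤ + a) - (b + 0ℤ)
        ring = solve-∀

      rows-triangle : ∀ t → t < suc m →
        + y (suc t) (suc (suc t)) * ((e t (suc (suc t)) (p , q) - e t (suc t) (p , q)) - e (suc t) (suc (suc t)) (p , q))
          ≡ term (suc t) (suc (suc t))
      rows-triangle t t< = row (suc t) (suc (suc t)) ℕₚ.≤-refl (s≤s (ℕₚ.m≤n⇒m≤1+n t<))
        (trans (ring (e t (suc (suc t)) (p , q)) (e t (suc t) (p , q)) (e (suc t) (suc (suc t)) (p , q)))
               (cong (λ i → (e t (suc (suc t)) (p , q) + i) - (e (suc t) (suc (suc t)) (p , q) + e t (suc t) (p , q)))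
                     (sym (e-diag (suc t)))))
        where
        ring : ∀ a b c → (a - b) - c ≡ (a + 0ℤ) - (c + b)
        ring = solve-∀

      row-inner : ∀ k → k < sink → ∀ j → j < k ∸ 2 →
        + y (suc j) k * ((e j k (p , q) + e (suc j) (k ∸ 1) (p , q)) - (e (suc j) k (p , q) + e j (k ∸ 1) (p , q))) ≡ term (suc j) k
      row-inner (suc (suc k)) k< j j<k = row (suc j) (suc (suc k)) (s≤s (ℕₚ.m≤n⇒m≤1+n j<k)) (ℕₚ.<⇒≤ k<) refl

      rows-inner : sumL (concatMap inner-rows (upTo sink)) value ≡ C
      rows-inner = trans (sumL-concatMap inner-rows (upTo sink) value)
                  (trans (sumL-upTo sink (λ k → sumL (inner-rows k) value))
                  (Σ<-cong sink λ k k< →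
                     trans (sumL-map-upTo (k ∸ 2) _ value) (Σ<-cong (k ∸ 2) (row-inner k k<))))

  certificate : Certificate (vars n) (system n) c
  certificate = weighted , point , weighted-rows
    , (λ { (p , q) v∈ → let (p<q , q≤n) = ∈-vars⁻ n p q v∈ in combined-weighted p q p<q q≤n })
    , complementary

theorem6p13 : (n : ℕ) → 2 ≤ n → TDI (vars n) (system n)
theorem6p13 (suc (suc m)) (s≤s (s≤s z≤n)) =
  certificates⇒TDI (vars (suc (suc m))) (system (suc (suc m))) (DualSolution.certificate m)
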